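{- Let $k\ge2$ and let $H=(V,E)$ be a directed $k$-uniform hypergraph with vertex set $V=[n]$. Let $\mathbb{F}$ be a field. Let $f\in(\mathbb{F}^n)^{\otimes k}$ be a tensor such that $f_{e_1,\dots,e_k}=0$ for every $e=(e_1,\dots,e_k)\in[n]^k$ that is not in $E$ and not of the form $(i,\dots,i)$, and such that $f_{i,\dots,i}=1$ for every $i\in[n]$. Then $\alpha(H)\le\mathrm{Q}_{\mathrm{s}}(f)$.
   Context: A directed $k$-uniform hypergraph is a pair $(V,E)$ with $V$ a finite set and $E\subseteq V^k$ a set of $k$-tuples. A subset $S\subseteq V$ is independent if $E\cap S^{k}=\emptyset$, and $\alpha(H)$ is the size of the largest independent set. For $r\ge0$ the unit tensor is $\langle r\rangle=\sum_{i=1}^r e_i^{\otimes k}\in(\mathbb{F}^r)^{\otimes k}$. The symmetric subrank $\mathrm{Q}_{\mathrm{s}}(f)$ of $f\in(\mathbb{F}^n)^{\otimes k}$ (not necessarily symmetric) is the largest $r$ such that there is a linear map $A:\mathbb{F}^n\to\mathbb{F}^r$ with $\langle r\rangle=A^{\otimes k}f$. -}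

module Defs where

open import Algebra.Apartness.Bundles using (HeytingCommutativeRing; HeytingField)
open import Algebra.Bundles using (CommutativeRing)
open import Algebra.Module.Bundles.Raw using (RawLeftModule)
open import Algebra.Module.Morphism.Structures using (module LeftModuleMorphisms)
import Algebra.Properties.CommutativeMonoid.Sum as Sum
open import Data.Bool.Base using (if_then_else_)
open import Data.Fin.Base using (Fin)
open import Data.Fin.Properties using (_≟_)
open import Data.Fin.Subset using (Subset; ∣_∣) renaming (_∈_ to _∈ˢ_)
open import Data.Nat.Base using (ℕ; zero; suc; _≤_)
open import Data.Product.Base using (_×_; ∃-syntax)
open import Data.Vec.Base using (Vec; []; _∷_; map; replicate)
open import Data.Vec.Functional using (Vector)
open import Data.Vec.Relation.Unary.All using (All)
open import Level using (Level; _⊔_; 0ℓ)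
open import Relation.Binary.PropositionalEquality.Core using (_≡_)
open import Relation.Nullary.Decidable.Core using (does)
open import Relation.Unary using (Pred; Empty; _∩_)

private
  variable
    a ℓ c ℓ₁ ℓ₂ : Level
    k n r : ℕ

IsLargest : Pred ℕ a → Pred ℕ a
IsLargest P m = P m × (∀ {i} → P i → i ≤ m)

-- Vertex set [n]; the predicate is the set of edges E ⊆ [n]ᵏ.
DirectedHypergraph : ℕ → ℕ → (ℓ : Level) → Set (Level.suc ℓ)
DirectedHypergraph k n ℓ = Pred (Vec (Fin n) k) ℓ

infix 8 _^ˢ_

_^ˢ_ : Subset n → (k : ℕ) → Pred (Vec (Fin n) k) 0ℓ
(S ^ˢ k) e = All (_∈ˢ S) e

IsIndependent : DirectedHypergraph k n ℓ → Pred (Subset n) ℓ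
IsIndependent {k = k} E S = Empty (E ∩ S ^ˢ k)

-- α(H) as a relation: "α(H) = m".
IsIndependenceNumber : DirectedHypergraph k n ℓ → Pred ℕ ℓ
IsIndependenceNumber E = IsLargest (λ m → ∃[ S ] (IsIndependent E S × ∣ S ∣ ≡ m))

-- A Heyting field whose apartness is the negation of equality is a field in
-- the usual sense; classically every Heyting field is of this form, since the
-- apartness is tight.  Invertibility of x - y is equivalent to x # y, and # is
-- irreflexive, so 0# and 1# are distinct.
module _ (F : HeytingField c ℓ₁ ℓ₂) where

  open HeytingField F using (Carrier; _≈_; _+_; _*_; -_; 0#; 1#; heytingCommutativeRing)
  open HeytingCommutativeRing heytingCommutativeRing using (commutativeRing)
  open Sum (CommutativeRing.+-commutativeMonoid commutativeRing) using (sum)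

  space : ℕ → RawLeftModule Carrier c ℓ₁
  space n = record
    { Carrierᴹ = Vector Carrier n
    ; _≈ᴹ_     = λ u v → ∀ i → u i ≈ v i
    ; _+ᴹ_     = λ u v i → u i + v i
    ; _*ₗ_     = λ x v i → x * v i
    ; 0ᴹ       = λ _ → 0#
    ; -ᴹ_      = λ v i → - v i
    }

  IsLinear : (Vector Carrier n → Vector Carrier r) → Set (c ⊔ ℓ₁)
  IsLinear {n = n} {r = r} =
    LeftModuleMorphisms.IsLeftModuleHomomorphism (space n) (space r)

  basis : Fin n → Vector Carrier n
  basis i j = if does (i ≟ j) then 1# else 0#

  -- An element of (Fⁿ)^⊗k, given by its coordinates f_{e₁,…,e_k}.
  Tensor : ℕ → ℕ → Set c
  Tensor k n = Vec (Fin n) k → Carrier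

  infix 4 _≈ᵀ_

  _≈ᵀ_ : Tensor k n → Tensor k n → Set ℓ₁
  f ≈ᵀ g = ∀ e → f e ≈ g e

  -- v₁ ⊗ ⋯ ⊗ v_k
  pure : Vec (Vector Carrier n) k → Tensor k n
  pure []       []       = 1#
  pure (v ∷ vs) (i ∷ is) = v i * pure vs is

  -- Summation over all index tuples in [n]ᵏ.
  sumTuples : (Vec (Fin n) k → Carrier) → Carrier
  sumTuples {k = zero}  g = g []
  sumTuples {k = suc k} g = sum (λ i → sumTuples (λ is → g (i ∷ is)))

  unitTensor : (k r : ℕ) → Tensor k r
  unitTensor k r j = sum (λ i → pure (replicate k (basis i)) j)

  -- A^⊗k f = Σ_{e ∈ [n]ᵏ} f_e (A e_{e₁} ⊗ ⋯ ⊗ A e_{e_k}), which is the linear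
  -- extension of v₁ ⊗ ⋯ ⊗ v_k ↦ A v₁ ⊗ ⋯ ⊗ A v_k.
  tensorPower : (Vector Carrier n → Vector Carrier r) → Tensor k n → Tensor k r
  tensorPower A f j = sumTuples (λ e → f e * pure (map (λ i → A (basis i)) e) j)

  -- Qₛ(f) as a relation: "Qₛ(f) = m".  The maximum exists classically for
  -- k ≥ 2: m = 0 always qualifies, and ⟨m⟩ = A^⊗k f forces A to have rank m,
  -- so m ≤ n.  Over a general field it cannot be computed constructively, hence
  -- no function Tensor k n → ℕ.
  IsSymmetricSubrank : Tensor k n → Pred ℕ (c ⊔ ℓ₁)
  IsSymmetricSubrank {k = k} {n = n} f =
    IsLargest (λ m → ∃[ A ] (IsLinear {n} {m} A × unitTensor k m ≈ᵀ tensorPower A f))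

{-# OPTIONS --safe #-}

-- For an independent set S of size m, the coordinate projection A : Fⁿ → F^S
-- sends f to its restriction to Sᵏ.  No edge lies in Sᵏ, so that restriction has
-- zeros off the diagonal and ones on it: it is ⟨m⟩, whence m ≤ Qₛ(f).
module Submission where

open import Defs
open import Algebra.Apartness.Bundles using (HeytingCommutativeRing; HeytingField)
open import Algebra.Bundles using (CommutativeRing)
import Algebra.Properties.Semiring.Sum as SemiringSum
open import Data.Fin.Base using (Fin; zero; suc)
open import Data.Fin.Properties using (_≟_; suc-injective)
open import Data.Fin.Subset using (Subset; inside; outside; ∣_∣) renaming (_∈_ to _∈ˢ_)
open import Data.Nat.Base using (ℕ; zero; suc; _≤_; s≤s)
open import Data.Product.Base using (_,_)
open import Data.Vec.Base using (Vec; []; _∷_; map; replicate; here; there)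
open import Data.Vec.Functional using (Vector)
open import Data.Vec.Properties using (≡-dec; ∷-injective; map-replicate)
open import Data.Vec.Relation.Unary.All using (universal)
open import Data.Vec.Relation.Unary.All.Properties using (map⁺)
open import Function.Base using (_∘_)
open import Function.Definitions using (Injective)
open import Relation.Binary.PropositionalEquality.Core as ≡ using (_≡_; _≢_; refl)
import Relation.Binary.Reasoning.Setoid as SetoidReasoning
open import Relation.Nullary.Decidable.Core using (yes; no)
open import Relation.Nullary.Negation.Core using (contradiction)
open import Relation.Unary using (_∉_)

private
  variable
    k n r : ℕ

-- The increasing enumeration of `S`. Its domain `Fin ∣ S ∣` makes the cardinality of `S` the
-- dimension of the target space.
lookupMember : (S : Subset n) → Fin ∣ S ∣ → Fin n
lookupMember (inside  ∷ S) zero    = zero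
lookupMember (inside  ∷ S) (suc a) = suc (lookupMember S a)
lookupMember (outside ∷ S) a       = suc (lookupMember S a)

lookupMember-∈ : (S : Subset n) (a : Fin ∣ S ∣) → lookupMember S a ∈ˢ S
lookupMember-∈ (inside  ∷ S) zero    = here
lookupMember-∈ (inside  ∷ S) (suc a) = there (lookupMember-∈ S a)
lookupMember-∈ (outside ∷ S) a       = there (lookupMember-∈ S a)

lookupMember-injective : (S : Subset n) → Injective _≡_ _≡_ (lookupMember S)
lookupMember-injective (inside  ∷ S) {zero}  {zero}  eq = refl
lookupMember-injective (inside  ∷ S) {suc a} {suc b} eq =
  ≡.cong suc (lookupMember-injective S (suc-injective eq))
lookupMember-injective (outside ∷ S) eq = lookupMember-injective S (suc-injective eq)

map-injective : ∀ {a b} {A : Set a} {B : Set b} {g : A → B} →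
                Injective _≡_ _≡_ g → Injective _≡_ _≡_ (map {n = n} g)
map-injective inj {[]}     {[]}     eq = refl
map-injective inj {x ∷ xs} {y ∷ ys} eq with x≡y , xs≡ys ← ∷-injective eq =
  ≡.cong₂ _∷_ (inj x≡y) (map-injective inj xs≡ys)

module _ {c ℓ₁ ℓ₂} (F : HeytingField c ℓ₁ ℓ₂) where

  open HeytingField F using (heytingCommutativeRing)
  open CommutativeRing (HeytingCommutativeRing.commutativeRing heytingCommutativeRing)
    hiding (zero) renaming (refl to ≈-refl)
  open SemiringSum semiring using (sum; sum-cong-≋; sum-replicate-zero; *-distribˡ-sum)
  open SetoidReasoning setoid

  basis-diag : (i : Fin n) → basis F i i ≈ 1#
  basis-diag i with i ≟ i
  ... | yes _   = ≈-refl
  ... | no  i≢i = contradiction refl i≢i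

  basis-offdiag : {i j : Fin n} → i ≢ j → basis F i j ≈ 0#
  basis-offdiag {i = i} {j} i≢j with i ≟ j
  ... | yes i≡j = contradiction i≡j i≢j
  ... | no  _   = ≈-refl

  -- The sifting property of the Kronecker delta, with the summation index as the label of the basis
  -- vector. It contracts one tensor index at a time and also collapses the sum defining the unit
  -- tensor. The recursion on `j` works because `basis F (suc i) (suc j)` computes to `basis F i j`.
  sum-basis : (j : Fin n) (g : Vector Carrier n) →
              sum (λ i → basis F i j * g i) ≈ g j
  sum-basis {n = suc n} zero g = begin
    1# * g zero + sum (λ i → 0# * g (suc i))
      ≈⟨ +-cong (*-identityˡ _) (sum-cong-≋ {n} (λ i → zeroˡ (g (suc i)))) ⟩
    g zero + sum {n} (λ _ → 0#)  ≈⟨ +-congˡ (sum-replicate-zero n) ⟩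
    g zero + 0#                  ≈⟨ +-identityʳ _ ⟩
    g zero                       ∎
  sum-basis (suc j) g = begin
    0# * g zero + sum (λ i → basis F i j * g (suc i))
      ≈⟨ +-cong (zeroˡ _) (sum-basis j (g ∘ suc)) ⟩
    0# + g (suc j)  ≈⟨ +-identityˡ _ ⟩
    g (suc j)       ∎

  sumTuples-cong : {g h : Tensor F k n} → _≈ᵀ_ F g h → sumTuples F g ≈ sumTuples F h
  sumTuples-cong {k = zero}  g≈h = g≈h []
  sumTuples-cong {k = suc k} {n = n} g≈h =
    sum-cong-≋ {n} (λ i → sumTuples-cong (λ is → g≈h (i ∷ is)))

  *-distribˡ-sumTuples : (x : Carrier) (g : Tensor F k n) →
                         x * sumTuples F g ≈ sumTuples F (λ e → x * g e)
  *-distribˡ-sumTuples {k = zero}          x g = ≈-refl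
  *-distribˡ-sumTuples {k = suc k} {n = n} x g = trans
    (*-distribˡ-sum {n} x _)
    (sum-cong-≋ {n} (λ i → *-distribˡ-sumTuples x (λ is → g (i ∷ is))))

  -- Pullback of coordinates along `s`; for injective `s` this is the coordinate projection onto the
  -- image of `s`.
  reindex : (Fin r → Fin n) → Vector Carrier n → Vector Carrier r
  reindex s v = v ∘ s

  reindex-isLinear : (s : Fin r → Fin n) → IsLinear F (reindex s)
  reindex-isLinear s = record
    { +ᴹ-isGroupHomomorphism = record
      { isMonoidHomomorphism = record
        { isMagmaHomomorphism = record
          { isRelHomomorphism = record { cong = λ u≈v → u≈v ∘ s }
          ; homo              = λ _ _ _ → ≈-refl
          }
        ; ε-homo = λ _ → ≈-refl
        }
      ; ⁻¹-homo = λ _ _ → ≈-refl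
      }
    ; *ₗ-homo = λ _ _ _ → ≈-refl
    }

  -- Induction on the order: coordinate `a` of the image of `basis F i` is `basis F i (s a)`, so
  -- summing over the first index keeps only `i = s a` and leaves the same claim for the slice of
  -- `f` at `s a`.
  tensorPower-reindex : (s : Fin r → Fin n) (f : Tensor F k n) (j : Vec (Fin r) k) →
                        tensorPower F (reindex s) f j ≈ f (map s j)
  tensorPower-reindex s f [] = *-identityʳ _
  tensorPower-reindex {n = n} {k = suc k} s f (a ∷ j) = begin
    sum (λ i → sumTuples F (λ e → f (i ∷ e) * (basis F i (s a) * rest e)))
      -- The factor of the first index does not depend on `e`; it is moved to the front so that it
      -- can leave the inner sum.
      ≈⟨ sum-cong-≋ {n} (λ i → sumTuples-cong (λ e → swap (f (i ∷ e)) (basis F i (s a)) (rest e))) ⟩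
    sum (λ i → sumTuples F (λ e → basis F i (s a) * (f (i ∷ e) * rest e)))
      ≈⟨ sum-cong-≋ {n} (λ i → *-distribˡ-sumTuples (basis F i (s a)) (λ e → f (i ∷ e) * rest e)) ⟨
    sum (λ i → basis F i (s a) * tensorPower F (reindex s) (λ e → f (i ∷ e)) j)
      ≈⟨ sum-basis (s a) _ ⟩
    tensorPower F (reindex s) (λ e → f (s a ∷ e)) j
      ≈⟨ tensorPower-reindex s (λ e → f (s a ∷ e)) j ⟩
    f (s a ∷ map s j)  ∎
    where
    rest : Tensor F k n
    rest e = pure F (map (λ i → reindex s (basis F i)) e) j

    swap : ∀ x y z → x * (y * z) ≈ y * (x * z)
    swap x y z = begin
      x * (y * z)  ≈⟨ *-assoc x y z ⟨
      x * y * z    ≈⟨ *-congʳ (*-comm x y) ⟩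
      y * x * z    ≈⟨ *-assoc y x z ⟩
      y * (x * z)  ∎

  pure-replicate-diag : ∀ k (i : Fin n) → pure F (replicate k (basis F i)) (replicate k i) ≈ 1#
  pure-replicate-diag zero    i = ≈-refl
  pure-replicate-diag (suc k) i =
    trans (*-cong (basis-diag i) (pure-replicate-diag k i)) (*-identityˡ 1#)

  -- Some entry of `j` differs from `i`, and its factor kills the product; the recursion strips the
  -- entries equal to `i` until that one is reached.
  pure-replicate-offdiag : (i : Fin n) (j : Vec (Fin n) k) → j ≢ replicate k i →
                           pure F (replicate k (basis F i)) j ≈ 0#
  pure-replicate-offdiag i []      j≢ = contradiction refl j≢
  pure-replicate-offdiag i (a ∷ j) j≢ with i ≟ a
  ... | no  i≢a  = zeroˡ _
  ... | yes refl = trans (*-identityˡ _) (pure-replicate-offdiag i j (j≢ ∘ ≡.cong (i ∷_)))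

  -- The first factor of each summand is a Kronecker delta, so a known first index `a` selects the
  -- summand `i = a`.
  unitTensor-∷ : (a : Fin r) (j : Vec (Fin r) k) →
                 unitTensor F (suc k) r (a ∷ j) ≈ pure F (replicate k (basis F a)) j
  unitTensor-∷ {k = k} a j = sum-basis a (λ i → pure F (replicate k (basis F i)) j)

  -- Both sides are 1 at constant tuples and 0 elsewhere. Injectivity of `s` ensures that `map s j`
  -- is constant only when `j` is. Vanishing is assumed only at tuples in the image of `s`, which is
  -- what independence will supply.
  unitTensor-restriction :
    (s : Fin r → Fin n) → Injective _≡_ _≡_ s → (f : Tensor F (suc k) n) →
    (∀ i → f (replicate (suc k) i) ≈ 1#) →
    (∀ j → (∀ i → map s j ≢ replicate (suc k) i) → f (map s j) ≈ 0#) →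
    ∀ j → unitTensor F (suc k) r j ≈ f (map s j)
  unitTensor-restriction {k = k} s s-inj f diag offdiag (a ∷ j)
    -- A tuple starting with `a` can only be constant with value `a`, so comparing its tail decides
    -- whether it lies on the diagonal.
    with ≡-dec _≟_ j (replicate k a)
  ... | yes refl = begin
    unitTensor F (suc k) _ (a ∷ replicate k a)        ≈⟨ unitTensor-∷ a (replicate k a) ⟩
    pure F (replicate k (basis F a)) (replicate k a)  ≈⟨ pure-replicate-diag k a ⟩
    1#                                                ≈⟨ diag (s a) ⟨
    f (replicate (suc k) (s a))                       ≡⟨ ≡.cong f (map-replicate s a (suc k)) ⟨
    f (map s (replicate (suc k) a))                   ∎
  ... | no j≢ = begin
    unitTensor F (suc k) _ (a ∷ j)      ≈⟨ unitTensor-∷ a j ⟩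
    pure F (replicate k (basis F a)) j  ≈⟨ pure-replicate-offdiag a j j≢ ⟩
    0#                                  ≈⟨ offdiag (a ∷ j) nonconstant ⟨
    f (map s (a ∷ j))                   ∎
    where
    nonconstant : ∀ i → map s (a ∷ j) ≢ replicate (suc k) i
    -- The heads force `i` to be `s a`; then `map s j` equals `map s (replicate k a)`, and
    -- cancelling `s` contradicts `j≢`.
    nonconstant i eq with s[a]≡i , s[j]≡ ← ∷-injective eq with refl ← s[a]≡i =
      j≢ (map-injective s-inj (≡.trans s[j]≡ (≡.sym (map-replicate s a k))))

proposition2p3 : ∀ {ℓ c ℓ₁ ℓ₂} (k n : ℕ) → 2 ≤ k →
    (E : DirectedHypergraph k n ℓ) →
    (F : HeytingField c ℓ₁ ℓ₂) →
    let open HeytingField F in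
    (f : Tensor F k n) →
    (∀ (e : Vec (Fin n) k) → e ∉ E → (∀ i → e ≢ replicate k i) → f e ≈ 0#) →
    (∀ (i : Fin n) → f (replicate k i) ≈ 1#) →
    ∀ (α Qₛ : ℕ) →
    IsIndependenceNumber E α →
    IsSymmetricSubrank F f Qₛ →
    α ≤ Qₛ
-- Matching on the bound exposes the first index used to evaluate the unit tensor. Matching `refl`
-- turns `α` into `∣ S ∣`, so the goal becomes an instance of the maximality of `Qₛ`.
proposition2p3 (suc k) n (s≤s _) E F f offdiag diag α Qₛ
  ((S , S-indep , refl) , _) (_ , Qₛ-max) =
  Qₛ-max (reindex F s , reindex-isLinear F s , λ j → F.trans
    (unitTensor-restriction F s (lookupMember-injective S) f diag
      -- An edge among the tuples `map s j` would have all its vertices in `S`, against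
      -- independence; hence `f` vanishes at the nonconstant ones.
      (λ j → offdiag (map s j) (λ j∈E → S-indep (map s j) (j∈E , s[j]∈Sᵏ j))) j)
    (F.sym (tensorPower-reindex F s f j)))
  where
  module F = CommutativeRing
    (HeytingCommutativeRing.commutativeRing (HeytingField.heytingCommutativeRing F))

  s : Fin ∣ S ∣ → Fin n
  s = lookupMember S

  s[j]∈Sᵏ : (j : Vec (Fin ∣ S ∣) (suc k)) → (S ^ˢ suc k) (map s j)
  s[j]∈Sᵏ j = map⁺ (universal (lookupMember-∈ S) j)
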